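{- Direct simulation equivalence is strictly finer than even-biased delayed simulation equivalence and strictly finer than odd-biased delayed simulation equivalence. That is, for each relation $\approx$ among $\equiv_{de}^{e}$ and $\equiv_{de}^{o}$: in every parity game, $v\equiv_d w$ implies $v\approx w$; and there is a parity game with vertices $v,w$ such that $v\approx w$ but not $v\equiv_d w$.
   Context: A parity game is a tuple $(V,\to,\Omega,\mathcal P)$ where $V$ is a finite set of vertices, $\to\subseteq V\times V$ is total (every vertex has at least one successor), $\Omega:V\to\mathbb N$ is a priority function, and $\mathcal P:V\to\{\Diamond,\Box\}$ assigns each vertex to player even ($\Diamond$) or odd ($\Box$). Write $v^\bullet=\{w\mid v\to w\}$. Move rules: from a position $(v,w)\in V\times V$, a new position $(v',w')$ with $v'\in v^\bullet$, $w'\in w^\bullet$ is chosen by Spoiler and Duplicator as follows: - $\mathcal P(v)=\Diamond,\mathcal P(w)=\Diamond$: Spoiler chooses $v'$, then Duplicator chooses $w'$; - $\mathcal P(v)=\Diamond,\mathcal P(w)=\Box$: Spoiler chooses $v'$, then Spoiler chooses $w'$; - $\mathcal P(v)=\Box,\mathcal P(w)=\Diamond$: Duplicator chooses $w'$, then Duplicator chooses $v'$; - $\mathcal P(v)=\Box,\mathcal P(w)=\Box$: Spoiler chooses $w'$, then Duplicator chooses $v'$. Direct simulation: in the direct simulation game, play proceeds in rounds by the move rules; Duplicator wins an infinite play $(v_0,w_0),(v_1,w_1),\dots$ iff $\Omega(v_j)=\Omega(w_j)$ for all $j$, otherwise Spoiler wins. $v\sqsubseteq_d w$ iff Duplicator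 has a winning strategy from $(v,w)$; $v\equiv_d w$ iff $v\sqsubseteq_d w$ and $w\sqsubseteq_d v$. Reward order: $n\preccurlyeq m$ iff $n$ is even and $m$ is odd; or both are even and $n\le m$; or both are odd and $m\le n$. Obligations: $K=\mathbb N\cup\{\checkmark\}$. Update $\gamma:\mathbb N\times\mathbb N\times K\to K$: $\gamma(n,m,\checkmark)=\checkmark$ if $m\preccurlyeq n$, else $\min\{n,m\}$; for $k\in\mathbb N$, $\gamma(n,m,k)=\checkmark$ if $m\preccurlyeq n$ and ($n$ odd and $n\le k$, or $m$ even and $m\le k$), else $\min\{n,m,k\}$ (usual order for $\min$). Even-biased update $\gamma^e$: for $k\in\mathbb N$, $\gamma^e(n,m,k)=k$ if $m\preccurlyeq n$, $n$ is odd, $n\le k$ and ($m$ is odd or $k<m$); $\gamma^e(n,m,k)=\gamma(n,m,k)$ otherwise. Odd-biased update $\gamma^o$: for $k\in\mathbb N$, $\gamma^o(n,m,k)=k$ if $m\preccurlyeq n$, $m$ is even, $m\le k$ and ($n$ is even or $k<n$); $\gamma^o(n,m,k)=\gamma(n,m,k)$ otherwise. For $k=\checkmark$ both equal $\gamma(n,m,\checkmark)$. For vertices, $\gamma^x(v,w,k)$ abbreviates $\gamma^x(\Omega(v),\Omega(w),k)$. For $x\in\{e,o\}$, the ($x$-)biased delayed simulation game is played in rounds on positions $(v,w)$ with an obligation $k\in K$: moves to $(v',w')$ are made by the move rules and play continues from $(v',w')$ with obligation $\gamma^x(v',w',k)$. Duplicator wins an infinite play $(v_0,w_0,k_0),(v_1,w_1,k_1),\dots$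 iff $k_j=\checkmark$ for infinitely many $j$; otherwise Spoiler wins. $v\sqsubseteq_{de}^{x}w$ iff Duplicator has a winning strategy from $(v,w)$ with obligation $\gamma^x(v,w,\checkmark)$; $v\equiv_{de}^{x}w$ iff $v\sqsubseteq_{de}^{x}w$ and $w\sqsubseteq_{de}^{x}v$. ($x=e$: even-biased; $x=o$: odd-biased.) -}

module Defs where

open import Data.Bool using (if_then_else_)
open import Data.Fin using (Fin)
open import Data.List using (List; applyUpTo)
open import Data.Nat using (ℕ; zero; suc; _⊓_; _≤_; _≤?_; _<?_)
open import Data.Nat.Divisibility using (_∣_; _∣?_)
open import Data.Product using (Σ; ∃; _×_; _,_; proj₁; proj₂)
open import Data.Sum using (_⊎_)
open import Data.Unit using (⊤)
open import Function.Bundles using (_↔_)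
open import Relation.Binary.PropositionalEquality using (_≡_)
open import Relation.Nullary using (¬_; Dec; does; ¬?; _×-dec_; _⊎-dec_)

data Player : Set where
  ◇ □ : Player

record ParityGame : Set₁ where
  infix 4 _⟶_
  field
    V      : Set
    finite : ∃ λ n → V ↔ Fin n
    _⟶_    : V → V → Set
    total  : ∀ v → ∃ λ w → v ⟶ w
    Ω      : V → ℕ
    owner  : V → Player

  _• : V → Set
  v • = ∃ λ w → v ⟶ w

Even Odd : ℕ → Set
Even n = 2 ∣ n
Odd  n = ¬ Even n

even? : ∀ n → Dec (Even n)
even? n = 2 ∣? n

odd? : ∀ n → Dec (Odd n)
odd? n = ¬? (even? n)

infix 4 _≼_ _≼?_

_≼_ : ℕ → ℕ → Set
n ≼ m = (Even n × Odd m)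
      ⊎ (Even n × Even m × n ≤ m)
      ⊎ (Odd n × Odd m × m ≤ n)

_≼?_ : ∀ n m → Dec (n ≼ m)
n ≼? m = (even? n ×-dec odd? m)
   ⊎-dec (even? n ×-dec even? m ×-dec n ≤? m)
   ⊎-dec (odd? n ×-dec odd? m ×-dec m ≤? n)

data K : Set where
  ✓  : K
  ob : ℕ → K

γ : ℕ → ℕ → K → K
γ n m ✓ = if does (m ≼? n) then ✓ else ob (n ⊓ m)
γ n m (ob k) =
  if does (m ≼? n ×-dec ((odd? n ×-dec n ≤? k) ⊎-dec (even? m ×-dec m ≤? k)))
  then ✓
  else ob (n ⊓ m ⊓ k)

γᵉ : ℕ → ℕ → K → K
γᵉ n m ✓ = γ n m ✓
γᵉ n m (ob k) =
  if does (m ≼? n ×-dec odd? n ×-dec n ≤? k ×-dec (odd? m ⊎-dec k <? m))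
  then ob k
  else γ n m (ob k)

γᵒ : ℕ → ℕ → K → K
γᵒ n m ✓ = γ n m ✓
γᵒ n m (ob k) =
  if does (m ≼? n ×-dec even? m ×-dec m ≤? k ×-dec (even? n ⊎-dec k <? n))
  then ob k
  else γ n m (ob k)

data Bias : Set where
  e o : Bias

γ[_] : Bias → ℕ → ℕ → K → K
γ[ e ] = γᵉ
γ[ o ] = γᵒ

module Simulation (G : ParityGame) where
  open ParityGame G

  Position : Set
  Position = V × V

  -- What Duplicator contributes to a round from (v , w), given the owners of
  -- v and w.  The edge proofs for Spoiler's choices are irrelevant, so that a
  -- reply depends only on the vertex chosen.
  Reply : Player → Player → V → V → Set
  Reply ◇ ◇ v w = (v' : V) → .(v ⟶ v') → w •
  Reply ◇ □ v w = ⊤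
  Reply □ ◇ v w = w • × v •
  Reply □ □ v w = (w' : V) → .(w ⟶ w') → v •

  -- The positions that Spoiler's choices can lead to against a fixed reply.
  Outcome : ∀ p q {v w} → Reply p q v w → Position → Set
  Outcome ◇ ◇ {v} {w} r (v' , w') = Σ (v ⟶ v') λ s → proj₁ (r v' s) ≡ w'
  Outcome ◇ □ {v} {w} r (v' , w') = (v ⟶ v') × (w ⟶ w')
  Outcome □ ◇ {v} {w} r (v' , w') = proj₁ (proj₁ r) ≡ w' × proj₁ (proj₂ r) ≡ v'
  Outcome □ □ {v} {w} r (v' , w') = Σ (w ⟶ w') λ s → proj₁ (r w' s) ≡ v'

  -- The list holds the positions strictly before (v , w), oldest first.
  -- Obligations are determined by the positions, so they are not recorded.
  Strategy : Set
  Strategy = List Position → (v w : V) → Reply (owner v) (owner w) v w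

  Play : Set
  Play = ℕ → Position

  Conforms : Strategy → Play → Set
  Conforms σ π = ∀ j → let (v , w) = π j in
    Outcome (owner v) (owner w) (σ (applyUpTo π j) v w) (π (suc j))

  DuplicatorWins : (Play → Set) → V → V → Set
  DuplicatorWins Win v w =
    Σ Strategy λ σ → ∀ π → π 0 ≡ (v , w) → Conforms σ π → Win π

  infix 4 _⊑d_ _⊑de[_]_

  DirectWin : Play → Set
  DirectWin π = ∀ j → let (v , w) = π j in Ω v ≡ Ω w

  _⊑d_ : V → V → Set
  v ⊑d w = DuplicatorWins DirectWin v w

  update : Bias → Position → K → K
  update x (v , w) = γ[ x ] (Ω v) (Ω w)

  obligation : Bias → Play → ℕ → K
  obligation x π zero    = update x (π zero) ✓
  obligation x π (suc j) = update x (π (suc j)) (obligation x π j)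

  DelayedWin : Bias → Play → Set
  DelayedWin x π = ∀ i → ∃ λ j → i ≤ j × obligation x π j ≡ ✓

  _⊑de[_]_ : V → Bias → V → Set
  v ⊑de[ x ] w = DuplicatorWins (DelayedWin x) v w

open ParityGame using (V)

infix 4 _⊢_≡d_ _⊢_≡de[_]_

_⊢_≡d_ : (G : ParityGame) → V G → V G → Set
G ⊢ v ≡d w = v ⊑d w × w ⊑d v
  where open Simulation G

_⊢_≡de[_]_ : (G : ParityGame) → V G → Bias → V G → Set
G ⊢ v ≡de[ x ] w = v ⊑de[ x ] w × w ⊑de[ x ] v
  where open Simulation G

{-# OPTIONS --safe #-}
module Submission where

open import Defs
open import Data.Fin using (Fin)
open import Data.Fin.Patterns using (0F; 1F)
open import Data.Nat using (ℕ; zero; suc; _+_)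
open import Data.Nat.Properties using (≤-refl; n≤1+n; m≢1+n+m)
open import Data.Product using (∃; _×_; _,_; proj₁; proj₂; map)
open import Data.Sum using (inj₁; inj₂)
open import Function.Construct.Identity using (↔-id)
open import Relation.Binary.PropositionalEquality
  using (_≡_; refl; cong; sym; trans)
open import Relation.Nullary using (¬_; yes; no)
open import Relation.Nullary.Decidable using (dec-true)
open ParityGame using (V)

-- Equal priorities never create an obligation, so a winning strategy in the
-- direct simulation game keeps the obligation at ✓ forever.  The inclusion is
-- strict because a difference between initial priorities may cost only a
-- temporary obligation in the delayed game, but loses the direct game at once.

≼-refl : ∀ n → n ≼ n
≼-refl n with even? n
... | yes even = inj₂ (inj₁ (even , even , ≤-refl))
... | no  odd  = inj₂ (inj₂ (odd , odd , ≤-refl))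

γ-equal-✓ : ∀ x n → γ[ x ] n n ✓ ≡ ✓
γ-equal-✓ e n rewrite dec-true (n ≼? n) (≼-refl n) = refl
-- Both biased updates reduce to `γ` at `✓`.
γ-equal-✓ o n = γ-equal-✓ e n

module _ (G : ParityGame) where
  open ParityGame G using (Ω)
  open Simulation G

  update-equal-✓ : ∀ x {v w} → Ω v ≡ Ω w → update x (v , w) ✓ ≡ ✓
  update-equal-✓ x eq rewrite eq = γ-equal-✓ x _

  direct⇒obligation-✓ : ∀ x π → DirectWin π → ∀ j → obligation x π j ≡ ✓
  direct⇒obligation-✓ x π win zero    = update-equal-✓ x (win zero)
  direct⇒obligation-✓ x π win (suc j) =
    trans (cong (update x (π (suc j))) (direct⇒obligation-✓ x π win j))
          (update-equal-✓ x (win (suc j)))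

  ⊑d⇒⊑de : ∀ x {v w} → v ⊑d w → v ⊑de[ x ] w
  -- The two games share their moves and strategies see positions only, so `σ` carries over.
  ⊑d⇒⊑de x (σ , wins) = σ , λ π start conf i →
    i , ≤-refl , direct⇒obligation-✓ x π (wins π start conf) i

-- At equal priorities the even-biased update discharges only even priorities
-- and the odd-biased update only odd ones.
sinkPriority : Bias → ℕ
sinkPriority e = 0
sinkPriority o = 1

sinkGame : Bias → ParityGame
sinkGame x = record
  { V      = Fin 2
  ; finite = 2 , ↔-id (Fin 2)
  ; _⟶_    = λ _ w → w ≡ 0F
  ; total  = λ _ → 0F , refl
  ; Ω      = λ { 0F → sinkPriority x ; 1F → 2 + sinkPriority x }
  ; owner  = λ _ → ◇
  }

-- The sink `0F` has the smaller priority, so a pending obligation can only be that priority, and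
-- meeting it on both sides discharges it.
sink-discharges : ∀ x v w → let open Simulation (sinkGame x) in
                  update x (0F , 0F) (update x (v , w) ✓) ≡ ✓
sink-discharges e 0F 0F = refl
sink-discharges e 0F 1F = refl
sink-discharges e 1F 0F = refl
sink-discharges e 1F 1F = refl
sink-discharges o 0F 0F = refl
sink-discharges o 0F 1F = refl
sink-discharges o 1F 0F = refl
sink-discharges o 1F 1F = refl

module _ (x : Bias) where
  open Simulation (sinkGame x)

  toSink : Strategy
  toSink _ _ _ _ _ = 0F , refl

  -- Every position after the first is `(0F , 0F)`: the first such visit discharges, and equal
  -- priorities then preserve `✓`.
  toSink-✓ : ∀ π → Conforms toSink π → ∀ j → obligation x π (suc j) ≡ ✓
  toSink-✓ π conf j with π (suc j) | conf j
  toSink-✓ π conf zero    | _ | refl , refl = sink-discharges x (proj₁ (π 0)) (proj₂ (π 0))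
  toSink-✓ π conf (suc j) | _ | refl , refl
    rewrite toSink-✓ π conf j = γ-equal-✓ x _

  ⊑de-sinkGame : ∀ v w → v ⊑de[ x ] w
  ⊑de-sinkGame v w = toSink , λ π _ conf i →
    -- Round 0 may leave an obligation pending, hence the shift to `suc i`.
    suc i , n≤1+n i , toSink-✓ π conf i

  ¬1⊑d0 : ¬ (1F ⊑d 0F)
  ¬1⊑d0 (σ , wins) = m≢1+n+m _ (sym (wins π refl conf 0))
    where
    π : Play
    π zero    = 1F , 0F
    π (suc _) = 0F , 0F

    conf : Conforms σ π
    -- Edges are equations with `0F`, so the edge proof in any reply of `σ` shows that the reply is
    -- `0F`.
    conf j = refl , proj₂ (σ _ _ _ 0F refl)

theorem23 : (x : Bias) →
    ((G : ParityGame) (v w : V G) → G ⊢ v ≡d w → G ⊢ v ≡de[ x ] w)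
    × (∃ λ (G : ParityGame) → ∃ λ (v : V G) → ∃ λ (w : V G) →
    (G ⊢ v ≡de[ x ] w) × (¬ (G ⊢ v ≡d w)))
theorem23 x =
    (λ G v w → map (⊑d⇒⊑de G x) (⊑d⇒⊑de G x))
  , sinkGame x , 1F , 0F
  , (⊑de-sinkGame x 1F 0F , ⊑de-sinkGame x 0F 1F)
  , λ (1⊑0 , _) → ¬1⊑d0 x 1⊑0
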